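{- Let $c_0$ be a proper $4$-colouring of the plane, let $\mu$ be a left-invariant finitely additive probability measure on $S_4\times E(2)$, and let $p_d$ be the associated monochromaticity probabilities (see context). Then $$p_{\frac{\sqrt6+\sqrt2}{2}}\ge\frac{13}{75}.$$
   Context: Identify the plane with $\mathbb C$. A proper $4$-colouring of the plane is a map $c_0:\mathbb C\to\{1,2,3,4\}$ such that no two points at distance $1$ have the same colour. Let $S_4$ be the group of permutations of the colours and $E(2)$ the group of Euclidean isometries of the plane. The group $S_4\times E(2)$ is amenable, so there is a finitely additive probability measure $\mu$ defined on all subsets of $S_4\times E(2)$ which is left-invariant, i.e. $\mu(gE)=\mu(E)$ for all $g\in S_4\times E(2)$ and $E\subseteq S_4\times E(2)$. For $(\sigma,T)\in S_4\times E(2)$ consider the (random) colouring $c=\sigma\circ c_0\circ T^{ -1}$. For $d\ge 0$, $p_d$ denotes the probability that two points $A,B$ at distance $d$ get the same colour: $p_d=\mu(\{(\sigma,T): c(A)=c(B)\})$; by left-invariance this does not depend on the choice of $A,B$ with $|AB|=d$. The existence of $c_0$ is a standing assumption, and $c_0,\mu$ are arbitrary but fixed. -}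

module Defs where

open import Level using (0ℓ)
open import Algebra.Bundles using (CommutativeRing; Group)
open import Algebra.Structures using (IsCommutativeRing)
import Algebra.Construct.DirectProduct as DirectProduct
import Algebra.Definitions.RawMonoid as RawMonoidDefs
import Algebra.Properties.Ring as RingProperties
import Algebra.Solver.Ring.NaturalCoefficients.Default as SemiringSolver
open import Data.Empty using (⊥-elim)
open import Data.Fin.Base using (Fin)
open import Data.Nat.Base using (ℕ)
open import Data.Product.Base using (∃; _×_; _,_; proj₁; proj₂)
open import Data.Sum.Base using (inj₁; inj₂)
import Data.Sum.Base as Sum
open import Data.Unit.Base using (tt)
open import Function.Base using (_∘_)
open import Function.Bundles using (_↔_; Inverse)
open import Function.Construct.Composition using (_↔-∘_)
open import Function.Construct.Identity using (↔-id)
open import Function.Construct.Symmetry using (↔-sym)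
open import Relation.Binary.Bundles using (Poset)
open import Relation.Binary.Definitions using (_Respects_)
open import Relation.Binary.PropositionalEquality
  using (_≡_; _≢_; _≗_; refl; sym; trans; cong; cong₂; subst; subst₂; module ≡-Reasoning)
open import Relation.Binary.Structures using (IsDecTotalOrder)
import Relation.Binary.Reasoning.PartialOrder as PosetReasoning
open import Relation.Nullary using (yes; no)
open import Relation.Unary using (Pred; _∈_; _≐_; _⊥_; U; _∪_)

-- The real numbers, given by their classical
-- characterisation up to isomorphism: a Dedekind-complete ordered field.
record CompleteOrderedField : Set₁ where
  infix  8 -_ _⁻¹
  infixl 7 _*_
  infixl 6 _+_
  infix  4 _≤_
  field
    Carrier           : Set
    _≤_               : Carrier → Carrier → Set
    _+_ _*_           : Carrier → Carrier → Carrier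
    -_ _⁻¹            : Carrier → Carrier
    0# 1#             : Carrier
    isCommutativeRing : IsCommutativeRing _≡_ _+_ _*_ -_ 0# 1#
    0≢1               : 0# ≢ 1#
    -- _⁻¹ is total; nothing is said about 0# ⁻¹.
    *-inverseʳ        : ∀ x → x ≢ 0# → x * x ⁻¹ ≡ 1#
    isDecTotalOrder   : IsDecTotalOrder _≡_ _≤_
    +-monoʳ-≤         : ∀ z {x y} → x ≤ y → z + x ≤ z + y
    *-nonNeg          : ∀ {x y} → 0# ≤ x → 0# ≤ y → 0# ≤ x * y

  UpperBound : Pred Carrier 0ℓ → Pred Carrier 0ℓ
  UpperBound S b = ∀ {x} → x ∈ S → x ≤ b

  field
    supremum : (S : Pred Carrier 0ℓ) → ∃ S → ∃ (UpperBound S) →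
               ∃ λ s → UpperBound S s × (∀ {b} → UpperBound S b → s ≤ b)

  commutativeRing : CommutativeRing 0ℓ 0ℓ
  commutativeRing = record { isCommutativeRing = isCommutativeRing }

  open IsCommutativeRing isCommutativeRing public
    using (+-comm; +-identityˡ; +-identityʳ; -‿inverseʳ; *-comm; *-assoc;
           *-identityˡ; *-identityʳ; zeroˡ; zeroʳ; distribˡ; distribʳ)
  open IsDecTotalOrder isDecTotalOrder public
    using (_≟_; _≤?_; total; antisym)
    renaming (refl to ≤-refl; reflexive to ≤-reflexive; trans to ≤-trans)

  infixl 6 _-_
  infixl 7 _/_
  _-_ _/_ : Carrier → Carrier → Carrier
  x - y = x + - y
  x / y = x * y ⁻¹

  fromℕ : ℕ → Carrier
  fromℕ n = n ×ᴹ 1#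
    where open RawMonoidDefs (CommutativeRing.+-rawMonoid commutativeRing) renaming (_×_ to _×ᴹ_)

module SquareRoot (R : CompleteOrderedField) where
  open CompleteOrderedField R

  private
    open SemiringSolver (CommutativeRing.commutativeSemiring commutativeRing)
      using (solve; _:+_; _:*_; _:=_)

    poset : Poset 0ℓ 0ℓ 0ℓ
    poset = record { isPartialOrder = IsDecTotalOrder.isPartialOrder isDecTotalOrder }

    open RingProperties (CommutativeRing.ring commutativeRing)
      using (-‿distribˡ-*; -‿distribʳ-*; -‿involutive)

  +-cancel-- : ∀ x y → x + (y - x) ≡ y
  +-cancel-- x y = begin
    x + (y + - x)  ≡⟨ cong (x +_) (+-comm y (- x)) ⟩
    x + (- x + y)  ≡⟨ sym (CommutativeRing.+-assoc commutativeRing x (- x) y) ⟩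
    x + - x + y    ≡⟨ cong (_+ y) (-‿inverseʳ x) ⟩
    0# + y         ≡⟨ +-identityˡ y ⟩
    y              ∎
    where open ≡-Reasoning

  +-monoˡ-≤ : ∀ z {x y} → x ≤ y → x + z ≤ y + z
  +-monoˡ-≤ z {x} {y} p = subst₂ _≤_ (+-comm z x) (+-comm z y) (+-monoʳ-≤ z p)

  +-mono-≤ : ∀ {x y u v} → x ≤ y → u ≤ v → x + u ≤ y + v
  +-mono-≤ {y = y} {u = u} p q = ≤-trans (+-monoˡ-≤ u p) (+-monoʳ-≤ y q)

  +-nonNeg : ∀ {x y} → 0# ≤ x → 0# ≤ y → 0# ≤ x + y
  +-nonNeg {x} {y} p q = subst (_≤ x + y) (+-identityˡ 0#) (+-mono-≤ p q)

  ≤⇒0≤- : ∀ {x y} → x ≤ y → 0# ≤ y - x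
  ≤⇒0≤- {x} {y} p = subst (_≤ y - x) (-‿inverseʳ x) (+-monoˡ-≤ (- x) p)

  x≤x+y : ∀ x {y} → 0# ≤ y → x ≤ x + y
  x≤x+y x {y} p = subst (_≤ x + y) (+-identityʳ x) (+-monoʳ-≤ x p)

  +-cancelˡ-≤ : ∀ z {x y} → z + x ≤ z + y → x ≤ y
  +-cancelˡ-≤ z {x} {y} p = subst₂ _≤_ (e x) (e y) (+-monoʳ-≤ (- z) p)
    where
    e : ∀ w → - z + (z + w) ≡ w
    e w = begin
      - z + (z + w)  ≡⟨ sym (CommutativeRing.+-assoc commutativeRing (- z) z w) ⟩
      - z + z + w    ≡⟨ cong (_+ w) (CommutativeRing.-‿inverseˡ commutativeRing z) ⟩
      0# + w         ≡⟨ +-identityˡ w ⟩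
      w              ∎
      where open ≡-Reasoning

  *-monoˡ-≤ : ∀ {z x y} → 0# ≤ z → x ≤ y → z * x ≤ z * y
  *-monoˡ-≤ {z} {x} {y} p q =
    subst (z * x ≤_) (trans (sym (distribˡ z x (y - x))) (cong (z *_) (+-cancel-- x y)))
      (x≤x+y (z * x) (*-nonNeg p (≤⇒0≤- q)))

  x*x-nonNeg : ∀ x → 0# ≤ x * x
  x*x-nonNeg x with total 0# x
  ... | inj₁ p = *-nonNeg p p
  ... | inj₂ p = subst (0# ≤_) e (*-nonNeg q q)
    where
    q : 0# ≤ - x
    q = subst (0# ≤_) (+-identityˡ (- x)) (≤⇒0≤- p)
    e : - x * - x ≡ x * x
    e = trans (sym (-‿distribˡ-* x (- x)))
          (trans (cong -_ (sym (-‿distribʳ-* x x))) (-‿involutive (x * x)))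

  0≤1 : 0# ≤ 1#
  0≤1 = subst (0# ≤_) (*-identityˡ 1#) (x*x-nonNeg 1#)

  *-cancel-⁻¹ : ∀ {z} → z ≢ 0# → ∀ x → z * (x / z) ≡ x
  *-cancel-⁻¹ {z} p x = begin
    z * (x * z ⁻¹)  ≡⟨ cong (z *_) (*-comm x (z ⁻¹)) ⟩
    z * (z ⁻¹ * x)  ≡⟨ sym (*-assoc z (z ⁻¹) x) ⟩
    z * z ⁻¹ * x    ≡⟨ cong (_* x) (*-inverseʳ z p) ⟩
    1# * x          ≡⟨ *-identityˡ x ⟩
    x               ∎
    where open ≡-Reasoning

  *-cancelˡ-≡ : ∀ {z x y} → z ≢ 0# → z * x ≡ z * y → x ≡ y
  *-cancelˡ-≡ {z} {x} {y} p q = trans (sym (e x)) (trans (cong (z ⁻¹ *_) q) (e y))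
    where
    e : ∀ w → z ⁻¹ * (z * w) ≡ w
    e w = trans (sym (*-assoc (z ⁻¹) z w))
            (trans (cong (_* w) (trans (*-comm (z ⁻¹) z) (*-inverseʳ z p))) (*-identityˡ w))

  *-cancelˡ-≤ : ∀ {z x y} → 0# ≤ z → z ≢ 0# → z * x ≤ z * y → x ≤ y
  *-cancelˡ-≤ {z} {x} {y} p n q with total x y
  ... | inj₁ r = r
  ... | inj₂ r = ≤-reflexive (*-cancelˡ-≡ n (antisym q (*-monoˡ-≤ p r)))

  module _ (x : Carrier) (0≤x : 0# ≤ x) where
    private
      S : Pred Carrier 0ℓ
      S y = 0# ≤ y × y * y ≤ x

      bounded : UpperBound S (x + 1#)
      bounded {y} (0≤y , yy≤x) with total y (x + 1#)
      ... | inj₁ p = p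
      ... | inj₂ p = begin
        y       ≡⟨ sym (*-identityʳ y) ⟩
        y * 1#  ≤⟨ *-monoˡ-≤ 0≤y 1≤y ⟩
        y * y   ≤⟨ yy≤x ⟩
        x       ≤⟨ x≤x+y x 0≤1 ⟩
        x + 1#  ∎
        where
        open PosetReasoning poset
        1≤y : 1# ≤ y
        1≤y = ≤-trans (subst (_≤ x + 1#) (+-identityˡ 1#) (+-monoˡ-≤ 1# 0≤x)) p

      0∈S : 0# ∈ S
      0∈S = ≤-refl , subst (_≤ x) (sym (zeroˡ 0#)) 0≤x

      sup : ∃ λ s → UpperBound S s × (∀ {b} → UpperBound S b → s ≤ b)
      sup = supremum S (0# , 0∈S) (x + 1# , bounded)

      s : Carrier
      s = proj₁ sup

      upper : UpperBound S s
      upper = proj₁ (proj₂ sup)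

      least : ∀ {b} → UpperBound S b → s ≤ b
      least = proj₂ (proj₂ sup)

      0≤s : 0# ≤ s
      0≤s = upper 0∈S

      x≤ss : s * s ≤ x → x ≤ s * s
      x≤ss p = begin
        x            ≡⟨ sym eδ ⟩
        s * s + δ    ≤⟨ +-monoʳ-≤ (s * s) δ≤0 ⟩
        s * s + 0#   ≡⟨ +-identityʳ (s * s) ⟩
        s * s        ∎
        where
        open PosetReasoning poset
        δ D ε : Carrier
        δ = x - s * s
        D = s + s + δ + 1#
        ε = δ / D
        eδ : s * s + δ ≡ x
        eδ = +-cancel-- (s * s) x
        0≤δ : 0# ≤ δ
        0≤δ = ≤⇒0≤- p
        0≤ss : 0# ≤ s + s + δ
        0≤ss = +-nonNeg (+-nonNeg 0≤s 0≤s) 0≤δ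
        0≤D : 0# ≤ D
        0≤D = +-nonNeg 0≤ss 0≤1
        D≢0 : D ≢ 0#
        D≢0 q = 0≢1 (antisym 0≤1 (subst₂ _≤_ (+-identityˡ 1#) q (+-monoˡ-≤ 1# 0≤ss)))
        Dε : D * ε ≡ δ
        Dε = *-cancel-⁻¹ D≢0 δ
        0≤ε : 0# ≤ ε
        0≤ε = *-cancelˡ-≤ 0≤D D≢0 (subst₂ _≤_ (sym (zeroʳ D)) (sym Dε) 0≤δ)
        δ≤D : δ ≤ D
        δ≤D = ≤-trans (subst (δ ≤_) (+-comm δ (s + s)) (x≤x+y δ (+-nonNeg 0≤s 0≤s)))
                (x≤x+y (s + s + δ) 0≤1)
        ε≤1 : ε ≤ 1#
        ε≤1 = *-cancelˡ-≤ 0≤D D≢0 (subst₂ _≤_ (sym Dε) (sym (*-identityʳ D)) δ≤D)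
        expand : ∀ a b → (a + b) * (a + b) ≡ a * a + b * (a + a + b)
        expand = solve 2 (λ a b → (a :+ b) :* (a :+ b) := a :* a :+ b :* (a :+ a :+ b)) refl
        inS : (s + ε) ∈ S
        inS = +-nonNeg 0≤s 0≤ε , (begin
          (s + ε) * (s + ε)          ≡⟨ expand s ε ⟩
          s * s + ε * (s + s + ε)
            ≤⟨ +-monoʳ-≤ (s * s) (*-monoˡ-≤ 0≤ε (+-mono-≤ (x≤x+y (s + s) 0≤δ) ε≤1)) ⟩
          s * s + ε * D              ≡⟨ cong (s * s +_) (trans (*-comm ε D) Dε) ⟩
          s * s + δ                  ≡⟨ eδ ⟩
          x                          ∎)
        ε≤0 : ε ≤ 0#
        ε≤0 = +-cancelˡ-≤ s (subst (s + ε ≤_) (sym (+-identityʳ s)) (upper inS))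
        δ≤0 : δ ≤ 0#
        δ≤0 = subst₂ _≤_ Dε (zeroʳ D) (*-monoˡ-≤ 0≤D ε≤0)

      ss≤x : x ≤ s * s → s * s ≤ x
      ss≤x p with s ≟ 0#
      ... | yes s≡0 = subst (_≤ x) (sym (trans (cong (_* s) s≡0) (zeroˡ s))) 0≤x
      ... | no s≢0 = begin
        s * s    ≡⟨ sym ed ⟩
        x + d    ≤⟨ +-monoʳ-≤ x d≤0 ⟩
        x + 0#   ≡⟨ +-identityʳ x ⟩
        x        ∎
        where
        open PosetReasoning poset
        d e : Carrier
        d = s * s - x
        e = d / (s + s)
        ed : x + d ≡ s * s
        ed = +-cancel-- x (s * s)
        0≤2s : 0# ≤ s + s
        0≤2s = +-nonNeg 0≤s 0≤s
        2s≢0 : s + s ≢ 0#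
        2s≢0 q = s≢0 (antisym (subst (s ≤_) q (x≤x+y s 0≤s)) 0≤s)
        ee : (s + s) * e ≡ d
        ee = *-cancel-⁻¹ 2s≢0 d
        square : ∀ a b → (a + b) * (a + b) + a * a ≡ ((a + b) + (a + b)) * a + b * b
        square = solve 2 (λ a b →
          (a :+ b) :* (a :+ b) :+ a :* a := ((a :+ b) :+ (a :+ b)) :* a :+ b :* b) refl
        amgm : ∀ {y} → (s + s) * y ≤ s * s + y * y
        amgm {y} = subst ((s + s) * y ≤_)
          (trans (cong (λ z → (z + z) * y + k * k) (sym ek))
            (trans (sym (square y k)) (cong (λ z → z * z + y * y) ek)))
          (x≤x+y ((s + s) * y) (x*x-nonNeg k))
          where
          k : Carrier
          k = s - y
          ek : y + k ≡ s
          ek = +-cancel-- y s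
        y+e≤s : ∀ {y} → y ∈ S → y + e ≤ s
        y+e≤s {y} (0≤y , yy≤x) = *-cancelˡ-≤ 0≤2s 2s≢0 (begin
          (s + s) * (y + e)            ≡⟨ distribˡ (s + s) y e ⟩
          (s + s) * y + (s + s) * e    ≡⟨ cong ((s + s) * y +_) ee ⟩
          (s + s) * y + d              ≤⟨ +-monoˡ-≤ d amgm ⟩
          s * s + y * y + d            ≤⟨ +-monoˡ-≤ d (+-monoʳ-≤ (s * s) yy≤x) ⟩
          s * s + x + d                ≡⟨ CommutativeRing.+-assoc commutativeRing (s * s) x d ⟩
          s * s + (x + d)              ≡⟨ cong (s * s +_) ed ⟩
          s * s + s * s                ≡⟨ sym (distribʳ s s s) ⟩
          (s + s) * s                  ∎)
        s≤s-e : s ≤ s - e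
        s≤s-e = least λ {y} y∈S →
          +-cancelˡ-≤ e (subst₂ _≤_ (+-comm y e) (sym (+-cancel-- e s)) (y+e≤s y∈S))
        e≤0 : e ≤ 0#
        e≤0 = +-cancelˡ-≤ s (subst₂ _≤_ (+-comm e s)
          (trans (+-cancel-- e s) (sym (+-identityʳ s))) (+-monoʳ-≤ e s≤s-e))
        d≤0 : d ≤ 0#
        d≤0 = subst₂ _≤_ ee (zeroʳ (s + s)) (*-monoˡ-≤ 0≤2s e≤0)

    ∃-sqrt : ∃ λ r → 0# ≤ r × r * r ≡ x
    ∃-sqrt with total (s * s) x
    ... | inj₁ p = s , 0≤s , antisym p (x≤ss p)
    ... | inj₂ p = s , 0≤s , antisym (ss≤x p) p

  -- The junk value at negative arguments is 0#.
  √ : Carrier → Carrier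
  √ x with 0# ≤? x
  ... | yes p = proj₁ (∃-sqrt x p)
  ... | no  _ = 0#

  √-nonNeg : ∀ x → 0# ≤ √ x
  √-nonNeg x with 0# ≤? x
  ... | yes p = proj₁ (proj₂ (∃-sqrt x p))
  ... | no  _ = ≤-refl

  √-square : ∀ {x} → 0# ≤ x → √ x * √ x ≡ x
  √-square {x} 0≤x with 0# ≤? x
  ... | yes p = proj₂ (proj₂ (∃-sqrt x p))
  ... | no ¬p = ⊥-elim (¬p 0≤x)

SymmetricGroup : Set → Group 0ℓ 0ℓ
SymmetricGroup A = record
  { Carrier = A ↔ A
  ; _≈_ = λ f g → to f ≗ to g
  ; _∙_ = _↔-∘_
  ; ε = ↔-id A
  ; _⁻¹ = ↔-sym
  ; isGroup = record
    { isMonoid = record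
      { isSemigroup = record
        { isMagma = record
          { isEquivalence = record
            { refl = λ _ → refl
            ; sym = λ p x → sym (p x)
            ; trans = λ p q x → trans (p x) (q x)
            }
          ; ∙-cong = λ {f} {f′} {g} {g′} p q x → trans (cong (to f) (q x)) (p (to g′ x))
          }
        ; assoc = λ _ _ _ _ → refl
        }
      ; identity = (λ _ _ → refl) , (λ _ _ → refl)
      }
    ; inverse = strictlyInverseʳ , strictlyInverseˡ
    ; ⁻¹-cong = λ {f} {g} → from-cong′ f g
    }
  }
  where
  open Inverse using (to; from; strictlyInverseˡ; strictlyInverseʳ)
  from-cong′ : (f g : A ↔ A) → to f ≗ to g → from f ≗ from g
  from-cong′ f g p y = begin
    from f y                  ≡⟨ cong (from f) (sym (strictlyInverseˡ g y)) ⟩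
    from f (to g (from g y))  ≡⟨ cong (from f) (sym (p (from g y))) ⟩
    from f (to f (from g y))  ≡⟨ strictlyInverseʳ f (from g y) ⟩
    from g y                  ∎
    where open ≡-Reasoning

module Plane (R : CompleteOrderedField) where
  open CompleteOrderedField R
  open SquareRoot R using (√)

  Point : Set
  Point = Carrier × Carrier

  dist : Point → Point → Carrier
  dist (x₁ , y₁) (x₂ , y₂) = √ ((x₁ - x₂) * (x₁ - x₂) + (y₁ - y₂) * (y₁ - y₂))

  record Isometry : Set where
    field
      bijection : Point ↔ Point
    open Inverse bijection public using (to; from)
    field
      isometric : ∀ A B → dist (to A) (to B) ≡ dist A B

  E2 : Group 0ℓ 0ℓ
  E2 = record
    { Carrier = Isometry
    ; _≈_ = λ S T → bijection S Sym.≈ bijection T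
    ; _∙_ = λ S T → record
      { bijection = bijection S Sym.∙ bijection T
      ; isometric = λ A B → trans (isometric S (to T A) (to T B)) (isometric T A B)
      }
    ; ε = record { bijection = Sym.ε ; isometric = λ _ _ → refl }
    ; _⁻¹ = λ T → record
      { bijection = bijection T Sym.⁻¹
      ; isometric = λ A B → trans (sym (isometric T (from T A) (from T B)))
          (cong₂ dist (strictlyInverseˡ (bijection T) A) (strictlyInverseˡ (bijection T) B))
      }
    ; isGroup = record
      { isMonoid = record
        { isSemigroup = record
          { isMagma = record
            { isEquivalence = record
              { refl = λ {T} → Sym.refl {bijection T}
              ; sym = λ {S} {T} → Sym.sym {bijection S} {bijection T}
              ; trans = λ {S} {T} {V} → Sym.trans {bijection S} {bijection T} {bijection V}
              }
            ; ∙-cong = λ {S} {S′} {T} {T′} →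
                Sym.∙-cong {bijection S} {bijection S′} {bijection T} {bijection T′}
            }
          ; assoc = λ S T V → Sym.assoc (bijection S) (bijection T) (bijection V)
          }
        ; identity = (λ T → Sym.identityˡ (bijection T)) , (λ T → Sym.identityʳ (bijection T))
        }
      ; inverse = (λ T → Sym.inverseˡ (bijection T)) , (λ T → Sym.inverseʳ (bijection T))
      ; ⁻¹-cong = λ {S} {T} → Sym.⁻¹-cong {bijection S} {bijection T}
      }
    }
    where
    module Sym = Group (SymmetricGroup Point)
    open Isometry
    open Inverse using (strictlyInverseˡ)

module _ (G : Group 0ℓ 0ℓ) where
  open Group G using (_≈_; _∙_) renaming (Carrier to |G|; sym to ≈-sym; trans to ≈-trans)

  -- A subset of G must not distinguish representatives of the same group element.
  record Subset : Set₁ where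
    field
      members  : Pred |G| 0ℓ
      respects : members Respects _≈_

  open Subset

  full : Subset
  full = record { members = U ; respects = λ _ _ → tt }

  infixr 6 _∪ˢ_
  _∪ˢ_ : Subset → Subset → Subset
  E ∪ˢ F = record
    { members  = members E ∪ members F
    ; respects = λ p → Sum.map (respects E p) (respects F p)
    }

  translate : |G| → Subset → Subset
  translate g E = record
    { members  = λ x → ∃ λ h → h ∈ members E × x ≈ g ∙ h
    ; respects = λ { p (h , h∈E , q) → h , h∈E , ≈-trans (≈-sym p) q }
    }

  record LeftInvariantProbability (R : CompleteOrderedField) : Set₁ where
    open CompleteOrderedField R
    field
      μ              : Subset → Carrier
      extensional    : ∀ {E F} → members E ≐ members F → μ E ≡ μ F
      nonNeg         : ∀ E → 0# ≤ μ E
      normalised     : μ full ≡ 1#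
      additive       : ∀ {E F} → members E ⊥ members F → μ (E ∪ˢ F) ≡ μ E + μ F
      left-invariant : ∀ g E → μ (translate g E) ≡ μ E

module Colouring (R : CompleteOrderedField) where
  open CompleteOrderedField R
  open Plane R

  Colour : Set
  Colour = Fin 4

  ProperColouring : (Point → Colour) → Set
  ProperColouring c = ∀ A B → dist A B ≡ 1# → c A ≢ c B

  S₄×E2 : Group 0ℓ 0ℓ
  S₄×E2 = DirectProduct.group (SymmetricGroup Colour) E2

  module _ (c₀ : Point → Colour) where

    randomColouring : Group.Carrier S₄×E2 → Point → Colour
    randomColouring (σ , T) = Inverse.to σ ∘ c₀ ∘ Isometry.from T

    randomColouring-cong : ∀ {g h} → Group._≈_ S₄×E2 g h →
                           randomColouring g ≗ randomColouring h
    randomColouring-cong {σ , S} {τ , T} (σ≈τ , S≈T) A = trans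
      (σ≈τ (c₀ (Isometry.from S A)))
      (cong (Inverse.to τ ∘ c₀) (Group.⁻¹-cong E2 {S} {T} S≈T A))

    monochromatic : Point → Point → Subset S₄×E2
    monochromatic A B = record
      { members  = λ g → randomColouring g A ≡ randomColouring g B
      ; respects = λ {g} {h} g≈h p → trans (sym (randomColouring-cong {g} {h} g≈h A))
          (trans p (randomColouring-cong {g} {h} g≈h B))
      }

{-# OPTIONS --safe #-}

-- Let oabc be a unit square with equilateral triangles oae and ocf erected
-- outwards, and let d = (√6 + √2)/2. The pairs ec, eb, fa, fb, fe are at distance d
-- and the diagonals ac, ob at distance √2. In a proper 4-colouring at least two of
-- these seven pairs are monochromatic:
--   * if both diagonals are, there is nothing to show;
--   * if neither is, the square uses all four colours, so e matches b or c and
--     f matches a or b;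
--   * if only ac is, then b, e, f avoid the colours of o and a, so two of them agree;
--   * if only ob is, then e (f) has the colour of c (of a) or the fourth colour,
--     so ec, fa or fe is monochromatic.
-- Hence 2 ≤ 5 p_d + 2 p_√2. An isosceles triangle with legs √2 and base 1 gives
-- p_√2 ≤ 1/2, and so p_d ≥ 1/5 > 13/75.

module Submission where

open import Defs
open import Level using (Level; 0ℓ)
open import Algebra.Bundles using (CommutativeRing; Group)
import Algebra.Properties.AbelianGroup as AbelianGroupProperties
import Algebra.Properties.CommutativeSemigroup as CommutativeSemigroupProperties
import Algebra.Properties.Ring as RingProperties
import Algebra.Properties.Semiring.Mult.TCOptimised as Multiples
import Algebra.Solver.Ring as RingSolver
open import Algebra.Solver.Ring.AlmostCommutativeRing
  using (_-Raw-AlmostCommutative⟶_; fromCommutativeRing)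
open import Data.Bool.Base using (if_then_else_)
open import Data.Empty using (⊥-elim)
open import Data.Fin.Base using (Fin)
open import Data.Fin.Properties using (all?) renaming (_≟_ to _≟ᶠ_)
open import Data.Integer.Base as ℤ using (ℤ; 0ℤ; 1ℤ)
import Data.Integer.Properties as ℤ
open import Data.List.Base using (List; []; _∷_; _++_; map; foldr)
open import Data.List.Properties using (map-cong)
open import Data.Maybe.Base using (Maybe; just; nothing)
open import Data.Nat.Base as ℕ using (ℕ; zero; suc; s≤s⁻¹)
import Data.Nat.Properties as ℕ
open import Data.Nat.ListAction using (sum)
open import Data.Product.Base using (∃; _×_; _,_; proj₁; proj₂; uncurry)
open import Data.Sum.Base using (inj₁; inj₂; [_,_])
open import Data.Unit.Base using (tt)
open import Function.Base using (_∘_)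
open import Function.Bundles using (Inverse; mk↔ₛ′)
open import Relation.Binary.Bundles using (Poset)
open import Relation.Binary.PropositionalEquality
  using (_≡_; _≢_; refl; sym; trans; cong; cong₂; subst; subst₂; module ≡-Reasoning)
open import Relation.Binary.Structures using (IsDecTotalOrder)
import Relation.Binary.Reasoning.PartialOrder as PosetReasoning
import Relation.Binary.Reasoning.Setoid as SetoidReasoning
open import Relation.Nullary using (Dec; yes; no; ¬_)
open import Relation.Nullary.Decidable using (does; toWitness; _⊎-dec_; _→-dec_; ¬?)
open import Relation.Unary using (Decidable; _∈_; _⊥_; _∩_; ∁)

-- A ring solver with integer coefficients

module IntegerCoefficients {c ℓ : Level} (R : CommutativeRing c ℓ) where
  open CommutativeRing R renaming (refl to ≈-refl; sym to ≈-sym; trans to ≈-trans)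
  open import Data.Integer.Base using (+_; -[1+_]; _⊖_)
  open RingProperties ring
    using (-‿distribˡ-*; -‿distribʳ-*; -‿involutive; -0#≈0#)
  open AbelianGroupProperties +-abelianGroup using () renaming (⁻¹-∙-comm to -‿+-comm)
  open CommutativeSemigroupProperties +-commutativeSemigroup using (interchange)
  open Multiples semiring using (×1-homo-*; ×-homo-+; 1+×) renaming (_×_ to _×ᴿ_)
  open SetoidReasoning setoid

  -- With the optimised multiples `fromℤ 1ℤ` reduces to `1#`, so `con 1ℤ` matches a literal `1#`
  -- definitionally.
  fromℤ : ℤ → Carrier
  fromℤ (+ n)    = n ×ᴿ 1#
  fromℤ -[1+ n ] = - (suc n ×ᴿ 1#)

  fromℤ-⊖ : ∀ m n → fromℤ (m ⊖ n) ≈ m ×ᴿ 1# - n ×ᴿ 1#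
  fromℤ-⊖ m       zero    = ≈-sym (≈-trans (+-congˡ -0#≈0#) (+-identityʳ (m ×ᴿ 1#)))
  fromℤ-⊖ zero    (suc n) = ≈-sym (+-identityˡ _)
  fromℤ-⊖ (suc m) (suc n) = begin
    fromℤ (suc m ⊖ suc n)                ≡⟨ cong fromℤ (ℤ.[1+m]⊖[1+n]≡m⊖n m n) ⟩
    fromℤ (m ⊖ n)                        ≈⟨ fromℤ-⊖ m n ⟩
    m ×ᴿ 1# - n ×ᴿ 1#                    ≈⟨ ≈-sym (+-identityˡ _) ⟩
    -- Inserting `1# - 1#` and interchanging raises both multiples by one.
    0# + (m ×ᴿ 1# - n ×ᴿ 1#)             ≈⟨ +-congʳ (≈-sym (-‿inverseʳ 1#)) ⟩
    1# - 1# + (m ×ᴿ 1# - n ×ᴿ 1#)        ≈⟨ interchange 1# (- 1#) (m ×ᴿ 1#) (- (n ×ᴿ 1#)) ⟩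
    1# + m ×ᴿ 1# + (- 1# - n ×ᴿ 1#)      ≈⟨ +-congˡ (-‿+-comm 1# (n ×ᴿ 1#)) ⟩
    1# + m ×ᴿ 1# - (1# + n ×ᴿ 1#)        ≈⟨ ≈-sym (+-cong (1+× m 1#) (-‿cong (1+× n 1#))) ⟩
    suc m ×ᴿ 1# - suc n ×ᴿ 1#            ∎

  fromℤ-+ : ∀ i j → fromℤ (i ℤ.+ j) ≈ fromℤ i + fromℤ j
  fromℤ-+ (+ m)    (+ n)    = ×-homo-+ 1# m n
  fromℤ-+ (+ m)    -[1+ n ] = fromℤ-⊖ m (suc n)
  fromℤ-+ -[1+ m ] (+ n)    = ≈-trans (fromℤ-⊖ n (suc m)) (+-comm _ _)
  fromℤ-+ -[1+ m ] -[1+ n ] = begin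
    - (suc (suc (m ℕ.+ n)) ×ᴿ 1#)            ≡⟨ cong (λ k → - (k ×ᴿ 1#)) (cong suc (ℕ.+-suc m n)) ⟨
    - ((suc m ℕ.+ suc n) ×ᴿ 1#)              ≈⟨ -‿cong (×-homo-+ 1# (suc m) (suc n)) ⟩
    - (suc m ×ᴿ 1# + suc n ×ᴿ 1#)            ≈⟨ ≈-sym (-‿+-comm _ _) ⟩
    - (suc m ×ᴿ 1#) - suc n ×ᴿ 1#            ∎

  fromℤ-neg : ∀ i → fromℤ (ℤ.- i) ≈ - fromℤ i
  fromℤ-neg (+ zero)  = ≈-sym -0#≈0#
  fromℤ-neg (+ suc n) = ≈-refl
  fromℤ-neg -[1+ n ]  = ≈-sym (-‿involutive _)

  fromℤ-*ʳ : ∀ m j → fromℤ (+ m ℤ.* j) ≈ m ×ᴿ 1# * fromℤ j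
  fromℤ-*ʳ m (+ n)    = ≈-trans (reflexive (cong fromℤ (sym (ℤ.pos-* m n)))) (×1-homo-* m n)
  fromℤ-*ʳ m -[1+ n ] = begin
    fromℤ (+ m ℤ.* -[1+ n ])          ≡⟨ cong fromℤ (ℤ.neg-distribʳ-* (+ m) (+ suc n)) ⟨
    fromℤ (ℤ.- (+ m ℤ.* + suc n))     ≈⟨ fromℤ-neg (+ m ℤ.* + suc n) ⟩
    - fromℤ (+ m ℤ.* + suc n)         ≈⟨ -‿cong (fromℤ-*ʳ m (+ suc n)) ⟩
    - (m ×ᴿ 1# * (suc n ×ᴿ 1#))       ≈⟨ -‿distribʳ-* _ _ ⟩
    m ×ᴿ 1# * - (suc n ×ᴿ 1#)         ∎

  fromℤ-* : ∀ i j → fromℤ (i ℤ.* j) ≈ fromℤ i * fromℤ j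
  fromℤ-* (+ m)    j = fromℤ-*ʳ m j
  fromℤ-* -[1+ m ] j = begin
    fromℤ (-[1+ m ] ℤ.* j)           ≡⟨ cong fromℤ (ℤ.neg-distribˡ-* (+ suc m) j) ⟨
    fromℤ (ℤ.- (+ suc m ℤ.* j))      ≈⟨ fromℤ-neg (+ suc m ℤ.* j) ⟩
    - fromℤ (+ suc m ℤ.* j)          ≈⟨ -‿cong (fromℤ-*ʳ (suc m) j) ⟩
    - (suc m ×ᴿ 1# * fromℤ j)        ≈⟨ -‿distribˡ-* _ _ ⟩
    - (suc m ×ᴿ 1#) * fromℤ j        ∎

  homomorphism : CommutativeRing.rawRing ℤ.+-*-commutativeRing
                 -Raw-AlmostCommutative⟶ fromCommutativeRing R
  homomorphism = record
    { ⟦_⟧    = fromℤ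
    ; +-homo = fromℤ-+
    ; *-homo = fromℤ-*
    ; -‿homo = fromℤ-neg
    ; 0-homo = ≈-refl
    ; 1-homo = ≈-refl
    }

  -- An abstract ring offers no equality test that computes, so coefficients are compared as
  -- integers. Answering `nothing` can only make the solver miss a cancellation.
  fromℤ-≟ : ∀ i j → Maybe (fromℤ i ≈ fromℤ j)
  fromℤ-≟ i j with i ℤ.≟ j
  ... | yes i≡j = just (reflexive (cong fromℤ i≡j))
  ... | no  _   = nothing

  open RingSolver _ _ homomorphism fromℤ-≟ public

≤-poset : CompleteOrderedField → Poset 0ℓ 0ℓ 0ℓ
≤-poset R = record { isPartialOrder = IsDecTotalOrder.isPartialOrder isDecTotalOrder }
  where open CompleteOrderedField R using (isDecTotalOrder)

indicator : ∀ {a} {A : Set a} → Dec A → ℕ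
indicator d = if does d then 1 else 0

-- Finitely additive measures

module Probability (R : CompleteOrderedField) (G : Group 0ℓ 0ℓ)
                   (P : LeftInvariantProbability G R) where
  open CompleteOrderedField R
  open SquareRoot R
  open LeftInvariantProbability P
  open Subset
  open CommutativeSemigroupProperties
    (CommutativeRing.+-commutativeSemigroup commutativeRing) using (interchange)

  infixl 7 _∩ˢ_ _∖ˢ_
  _∩ˢ_ _∖ˢ_ : Subset G → Subset G → Subset G
  F ∩ˢ E = record
    { members  = members F ∩ members E
    ; respects = λ x≈y (x∈F , x∈E) → respects F x≈y x∈F , respects E x≈y x∈E
    }
  F ∖ˢ E = record
    { members  = members F ∩ ∁ (members E)
    ; respects = λ x≈y (x∈F , x∉E) →
        respects F x≈y x∈F , λ y∈E → x∉E (respects E (Group.sym G x≈y) y∈E)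
    }

  -- Decidability of `E` supplies the case distinction constructively.
  μ-split : ∀ F E → Decidable (members E) → μ F ≡ μ (F ∩ˢ E) + μ (F ∖ˢ E)
  μ-split F E E? = trans
    (extensional (split , [ proj₁ , proj₁ ]))
    (additive λ ((_ , x∈E) , (_ , x∉E)) → x∉E x∈E)
    where
    split : ∀ {x} → x ∈ members F → x ∈ members ((_∪ˢ_ G) (F ∩ˢ E) (F ∖ˢ E))
    split {x} x∈F with E? x
    ... | yes x∈E = inj₁ (x∈F , x∈E)
    ... | no  x∉E = inj₂ (x∈F , x∉E)

  -- An empty set is disjoint from itself, so additivity on F ∪ F = F gives μ F = 2 μ F.
  μ-empty : ∀ F → (∀ {x} → ¬ x ∈ members F) → μ F ≡ 0#
  μ-empty F ∅ = antisym
    (+-cancelˡ-≤ (μ F) (≤-reflexive (trans (sym μF≡2μF) (sym (+-identityʳ (μ F))))))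
    (nonNeg F)
    where
    μF≡2μF : μ F ≡ μ F + μ F
    μF≡2μF = trans (extensional (inj₁ , [ (λ x∈F → x∈F) , (λ x∈F → x∈F) ]))
                   (additive λ (x∈F , _) → ∅ x∈F)

  μ≤1 : ∀ {F} → Decidable (members F) → μ F ≤ 1#
  μ≤1 {F} F? = subst (μ F ≤_) (trans (sym 1-split) normalised)
    (x≤x+y (μ F) (nonNeg (full G ∖ˢ F)))
    where
    1-split : μ (full G) ≡ μ F + μ (full G ∖ˢ F)
    1-split = trans (μ-split (full G) F F?)
      (cong (_+ μ (full G ∖ˢ F)) (extensional (proj₂ , λ x∈F → tt , x∈F)))

  module _ {I : Set} (E : I → Subset G) (E? : ∀ i → Decidable (members (E i))) where

    multiplicity : Group.Carrier G → List I → ℕ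
    multiplicity x is = sum (map (λ i → indicator (E? i x)) is)

    private
      -- The sum is localised to `F` so that the induction in `cover` can condition on one set after
      -- another.
      mass : Subset G → List I → Carrier
      mass F is = foldr _+_ 0# (map (λ i → μ (F ∩ˢ E i)) is)

      ∩-split : ∀ F E′ D → Decidable (members D) →
                μ (F ∩ˢ E′) ≡ μ (F ∩ˢ D ∩ˢ E′) + μ (F ∖ˢ D ∩ˢ E′)
      ∩-split F E′ D D? = trans (μ-split (F ∩ˢ E′) D D?) (cong₂ _+_
        (extensional ((λ ((f , e) , d) → (f , d) , e) , λ ((f , d) , e) → (f , e) , d))
        (extensional ((λ ((f , e) , d) → (f , d) , e) , λ ((f , d) , e) → (f , e) , d)))

      mass-split : ∀ F D → Decidable (members D) → ∀ is →
                    mass F is ≡ mass (F ∩ˢ D) is + mass (F ∖ˢ D) is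
      mass-split F D D? []       = sym (+-identityˡ 0#)
      mass-split F D D? (i ∷ is) = trans
        (cong₂ _+_ (∩-split F (E i) D D?) (mass-split F D D? is)) (interchange _ _ _ _)

      mass-nonNeg : ∀ F is → 0# ≤ mass F is
      mass-nonNeg F []       = ≤-refl
      mass-nonNeg F (i ∷ is) = +-nonNeg (nonNeg (F ∩ˢ E i)) (mass-nonNeg F is)

      -- Conditioning on the first set E i of the list: inside it one of the k
      -- incidences is used up, outside it all k remain.
      cover : ∀ k is F → (∀ {x} → x ∈ members F → k ℕ.≤ multiplicity x is) →
              fromℕ k * μ F ≤ mass F is
      cover zero    is       F h = subst (_≤ mass F is) (sym (zeroˡ (μ F))) (mass-nonNeg F is)
      -- No incidences remain although at least one is required, so `F` is empty.
      cover (suc k) []       F h = ≤-reflexive (trans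
        (cong (fromℕ (suc k) *_) (μ-empty F λ x∈F → ℕ.n≮0 (h x∈F))) (zeroʳ _))
      cover (suc k) (i ∷ is) F h = begin
        fromℕ (suc k) * μ F
          ≡⟨ cong (fromℕ (suc k) *_) (μ-split F (E i) (E? i)) ⟩
        fromℕ (suc k) * (μ inside + μ outside)
          ≡⟨ distribˡ (fromℕ (suc k)) (μ inside) (μ outside) ⟩
        fromℕ (suc k) * μ inside + fromℕ (suc k) * μ outside
          ≡⟨ cong (_+ fromℕ (suc k) * μ outside)
               (trans (distribʳ (μ inside) 1# (fromℕ k))
                 (cong (_+ fromℕ k * μ inside) (*-identityˡ (μ inside)))) ⟩
        μ inside + fromℕ k * μ inside + fromℕ (suc k) * μ outside
          ≤⟨ +-mono-≤ (+-monoʳ-≤ (μ inside) (cover k is inside h-inside))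
                      (cover (suc k) is outside h-outside) ⟩
        μ inside + mass inside is + mass outside is
          ≡⟨ CommutativeRing.+-assoc commutativeRing _ _ _ ⟩
        μ inside + (mass inside is + mass outside is)
          ≡⟨ cong (μ inside +_) (sym (mass-split F (E i) (E? i) is)) ⟩
        mass F (i ∷ is) ∎
        where
        open PosetReasoning (≤-poset R)
        inside outside : Subset G
        inside  = F ∩ˢ E i
        outside = F ∖ˢ E i
        h-inside : ∀ {x} → x ∈ members inside → k ℕ.≤ multiplicity x is
        h-inside {x} (x∈F , x∈E) with E? i x | h x∈F
        ... | yes _   | p = s≤s⁻¹ p
        ... | no  x∉E | _ = ⊥-elim (x∉E x∈E)
        h-outside : ∀ {x} → x ∈ members outside → suc k ℕ.≤ multiplicity x is
        h-outside {x} (x∈F , x∉E) with E? i x | h x∈F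
        ... | yes x∈E | _ = ⊥-elim (x∉E x∈E)
        ... | no  _   | p = p

    -- A count that is everywhere at least `k` has mean at least `k`. Only finitely many sets occur,
    -- so finite additivity suffices and no integral is introduced.
    multiple-cover : ∀ k is → (∀ x → k ℕ.≤ multiplicity x is) →
                     fromℕ k ≤ foldr _+_ 0# (map (λ i → μ (E i)) is)
    multiple-cover k is h = subst₂ _≤_
      (trans (cong (fromℕ k *_) normalised) (*-identityʳ (fromℕ k)))
      (cong (foldr _+_ 0#) (map-cong (λ i → extensional (proj₂ , λ x∈E → tt , x∈E)) is))
      (cover k is (full G) λ {x} _ → h x)

-- Congruent pairs of points

module Geometry (R : CompleteOrderedField) where
  open CompleteOrderedField R
  open SquareRoot R
  open Plane R
  open IntegerCoefficients commutativeRing public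
    using (solve; _:=_; _:+_; _:*_; _:-_; :-_; con; Polynomial)

  -- Squared distances are polynomial in the coordinates and thus within reach of the ring solver.
  dist² : Point → Point → Carrier
  dist² (x₁ , y₁) (x₂ , y₂) = (x₁ - x₂) * (x₁ - x₂) + (y₁ - y₂) * (y₁ - y₂)

  :dist² : ∀ {n} → (A B : Polynomial n × Polynomial n) → Polynomial n
  :dist² (x₁ , y₁) (x₂ , y₂) = (x₁ :- x₂) :* (x₁ :- x₂) :+ (y₁ :- y₂) :* (y₁ :- y₂)

  dist²-nonNeg : ∀ A B → 0# ≤ dist² A B
  dist²-nonNeg _ _ = +-nonNeg (x*x-nonNeg _) (x*x-nonNeg _)

  dist-squared : ∀ A B → dist A B * dist A B ≡ dist² A B
  dist-squared A B = √-square (dist²-nonNeg A B)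

  -- Equal squares give (x + y) x = (x + y) y. Either x + y cancels, or it is zero and both
  -- nonnegative summands vanish.
  square-injective : ∀ {x y} → 0# ≤ x → 0# ≤ y → x * x ≡ y * y → x ≡ y
  square-injective {x} {y} 0≤x 0≤y xx≡yy with (x + y) ≟ 0#
  ... | yes x+y≡0 = trans (vanish 0≤x 0≤y x+y≡0)
                          (sym (vanish 0≤y 0≤x (trans (+-comm y x) x+y≡0)))
    where
    vanish : ∀ {u v} → 0# ≤ u → 0# ≤ v → u + v ≡ 0# → u ≡ 0#
    vanish {u} 0≤u 0≤v u+v≡0 = antisym (subst (u ≤_) u+v≡0 (x≤x+y u 0≤v)) 0≤u
  ... | no  x+y≢0 = *-cancelˡ-≡ x+y≢0 (trans
    (solve 2 (λ x y → (x :+ y) :* x := x :* x :+ x :* y) refl x y)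
    (trans (cong (_+ x * y) xx≡yy)
      (solve 2 (λ x y → y :* y :+ x :* y := (x :+ y) :* y) refl x y)))

  dist²≡1⇒dist≡1 : ∀ A B → dist² A B ≡ 1# → dist A B ≡ 1#
  dist²≡1⇒dist≡1 A B p = square-injective (√-nonNeg _) 0≤1
    (trans (dist-squared A B) (trans p (sym (*-identityˡ 1#))))

  -- This reduces an equation that holds modulo the relation e = 1 to a pure ring identity: `a` is
  -- the cofactor of e - 1.
  modulo : ∀ {e x y} → e ≡ 1# → ∀ a → x ≡ y + a * (e - 1#) → x ≡ y
  modulo {y = y} e≡1 a p = trans p (trans
    (cong (λ e → y + a * (e - 1#)) e≡1)
    (solve 2 (λ y a → y :+ a :* (con 1ℤ :- con 1ℤ) := y) refl y a))

  -- The motion z ↦ w z + s, where w = u + i v is a unit.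
  module _ (u v : Carrier) (s : Point) (unit : u * u + v * v ≡ 1#) where

    private
      rotate : Point → Point
      rotate (x , y) = u * x - v * y + proj₁ s , v * x + u * y + proj₂ s

      rotate⁻¹ : Point → Point
      rotate⁻¹ (x , y) = u * (x - proj₁ s) + v * (y - proj₂ s) ,
                         u * (y - proj₂ s) - v * (x - proj₁ s)

      rotate-rotate⁻¹ : ∀ A → rotate (rotate⁻¹ A) ≡ A
      rotate-rotate⁻¹ (x , y) = cong₂ _,_
        (modulo unit (x - proj₁ s) (solve 6 (λ u v x y s t →
          u :* (u :* (x :- s) :+ v :* (y :- t)) :- v :* (u :* (y :- t) :- v :* (x :- s)) :+ s
          := x :+ (x :- s) :* (u :* u :+ v :* v :- con 1ℤ))
          refl u v x y (proj₁ s) (proj₂ s)))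
        (modulo unit (y - proj₂ s) (solve 6 (λ u v x y s t →
          v :* (u :* (x :- s) :+ v :* (y :- t)) :+ u :* (u :* (y :- t) :- v :* (x :- s)) :+ t
          := y :+ (y :- t) :* (u :* u :+ v :* v :- con 1ℤ))
          refl u v x y (proj₁ s) (proj₂ s)))

      rotate⁻¹-rotate : ∀ A → rotate⁻¹ (rotate A) ≡ A
      rotate⁻¹-rotate (x , y) = cong₂ _,_
        (modulo unit x (solve 6 (λ u v x y s t →
          u :* (u :* x :- v :* y :+ s :- s) :+ v :* (v :* x :+ u :* y :+ t :- t)
          := x :+ x :* (u :* u :+ v :* v :- con 1ℤ))
          refl u v x y (proj₁ s) (proj₂ s)))
        (modulo unit y (solve 6 (λ u v x y s t →
          u :* (v :* x :+ u :* y :+ t :- t) :- v :* (u :* x :- v :* y :+ s :- s)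
          := y :+ y :* (u :* u :+ v :* v :- con 1ℤ))
          refl u v x y (proj₁ s) (proj₂ s)))

      rotate-dist² : ∀ A B → dist² (rotate A) (rotate B) ≡ dist² A B
      rotate-dist² A@(x₁ , y₁) B@(x₂ , y₂) = modulo unit (dist² A B)
        (solve 8 (λ u v s t x₁ y₁ x₂ y₂ →
          :dist² (u :* x₁ :- v :* y₁ :+ s , v :* x₁ :+ u :* y₁ :+ t)
                 (u :* x₂ :- v :* y₂ :+ s , v :* x₂ :+ u :* y₂ :+ t)
          := :dist² (x₁ , y₁) (x₂ , y₂) :+
             :dist² (x₁ , y₁) (x₂ , y₂) :* (u :* u :+ v :* v :- con 1ℤ))
          refl u v (proj₁ s) (proj₂ s) x₁ y₁ x₂ y₂)

    motion : Isometry
    motion = record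
      { bijection = mk↔ₛ′ rotate rotate⁻¹ rotate-rotate⁻¹ rotate⁻¹-rotate
      ; isometric = λ A B → cong √ (rotate-dist² A B)
      }

  -- In complex notation, the unit is w = (D − C) conj(B − A) / |B − A|².
  congruent⇒isometry : ∀ A B C D → dist² A B ≡ dist² C D → dist² A B ≢ 0# →
                       ∃ λ T → Isometry.to T A ≡ C × Isometry.to T B ≡ D
  congruent⇒isometry A@(a₁ , a₂) B@(b₁ , b₂) C@(c₁ , c₂) D@(d₁ , d₂) n≡m n≢0 =
    motion u v s unit , cong₂ _,_
      (solve 5 (λ u v c a b → u :* a :- v :* b :+ (c :- (u :* a :- v :* b)) := c) refl
        u v c₁ a₁ a₂)
      (solve 5 (λ u v c a b → v :* a :+ u :* b :+ (c :- (v :* a :+ u :* b)) := c) refl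
        u v c₂ a₁ a₂)
    , cong₂ _,_
      -- Here w (B - A) = n k (D - C), so the image of `B` differs from `D` by (n k - 1)(D - C).
      (modulo nk≡1 (d₁ - c₁) (solve 9 (λ a₁ a₂ b₁ b₂ c₁ c₂ d₁ d₂ k →
        :u a₁ a₂ b₁ b₂ c₁ c₂ d₁ d₂ k :* b₁ :- :v a₁ a₂ b₁ b₂ c₁ c₂ d₁ d₂ k :* b₂ :+
        (c₁ :- (:u a₁ a₂ b₁ b₂ c₁ c₂ d₁ d₂ k :* a₁ :- :v a₁ a₂ b₁ b₂ c₁ c₂ d₁ d₂ k :* a₂))
        := d₁ :+ (d₁ :- c₁) :* (:dist² (a₁ , a₂) (b₁ , b₂) :* k :- con 1ℤ))
        refl a₁ a₂ b₁ b₂ c₁ c₂ d₁ d₂ k))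
      (modulo nk≡1 (d₂ - c₂) (solve 9 (λ a₁ a₂ b₁ b₂ c₁ c₂ d₁ d₂ k →
        :v a₁ a₂ b₁ b₂ c₁ c₂ d₁ d₂ k :* b₁ :+ :u a₁ a₂ b₁ b₂ c₁ c₂ d₁ d₂ k :* b₂ :+
        (c₂ :- (:v a₁ a₂ b₁ b₂ c₁ c₂ d₁ d₂ k :* a₁ :+ :u a₁ a₂ b₁ b₂ c₁ c₂ d₁ d₂ k :* a₂))
        := d₂ :+ (d₂ :- c₂) :* (:dist² (a₁ , a₂) (b₁ , b₂) :* k :- con 1ℤ))
        refl a₁ a₂ b₁ b₂ c₁ c₂ d₁ d₂ k))
    where
    n k u v : Carrier
    n = dist² A B
    k = n ⁻¹
    u = ((d₁ - c₁) * (b₁ - a₁) + (d₂ - c₂) * (b₂ - a₂)) * k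
    v = ((d₂ - c₂) * (b₁ - a₁) - (d₁ - c₁) * (b₂ - a₂)) * k
    s : Point
    -- The translation is solved from the requirement that `A` goes to `C`.
    s = c₁ - (u * a₁ - v * a₂) , c₂ - (v * a₁ + u * a₂)

    :u :v : ∀ {n} (a₁ a₂ b₁ b₂ c₁ c₂ d₁ d₂ k : Polynomial n) → Polynomial n
    :u a₁ a₂ b₁ b₂ c₁ c₂ d₁ d₂ k =
      ((d₁ :- c₁) :* (b₁ :- a₁) :+ (d₂ :- c₂) :* (b₂ :- a₂)) :* k
    :v a₁ a₂ b₁ b₂ c₁ c₂ d₁ d₂ k =
      ((d₂ :- c₂) :* (b₁ :- a₁) :- (d₁ :- c₁) :* (b₂ :- a₂)) :* k

    nk≡1 : n * k ≡ 1#
    nk≡1 = *-inverseʳ n n≢0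

    unit : u * u + v * v ≡ 1#
    unit = begin
      u * u + v * v
        ≡⟨ solve 9 (λ a₁ a₂ b₁ b₂ c₁ c₂ d₁ d₂ k →
             :u a₁ a₂ b₁ b₂ c₁ c₂ d₁ d₂ k :* :u a₁ a₂ b₁ b₂ c₁ c₂ d₁ d₂ k :+
             :v a₁ a₂ b₁ b₂ c₁ c₂ d₁ d₂ k :* :v a₁ a₂ b₁ b₂ c₁ c₂ d₁ d₂ k
             := :dist² (c₁ , c₂) (d₁ , d₂) :* k :* (:dist² (a₁ , a₂) (b₁ , b₂) :* k))
             refl a₁ a₂ b₁ b₂ c₁ c₂ d₁ d₂ k ⟩
      -- Congruence of the two pairs enters here, turning |w|² into (n k)².
      dist² C D * k * (n * k)   ≡⟨ cong (λ m → m * k * (n * k)) (sym n≡m) ⟩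
      n * k * (n * k)           ≡⟨ cong₂ _*_ nk≡1 nk≡1 ⟩
      1# * 1#                   ≡⟨ *-identityˡ 1# ⟩
      1#                        ∎
      where open ≡-Reasoning

-- Monochromaticity probabilities

module Probabilities (R : CompleteOrderedField) where
  open CompleteOrderedField R
  open SquareRoot R
  open Plane R
  open Colouring R
  open Geometry R
  open Isometry using (to; from; bijection; isometric)

  module _ (c₀ : Point → Colour) where

    monochromatic? : ∀ A B → Decidable (Subset.members (monochromatic c₀ A B))
    monochromatic? A B g = randomColouring c₀ g A ≟ᶠ randomColouring c₀ g B

    randomColouring-proper : ProperColouring c₀ → ∀ g → ProperColouring (randomColouring c₀ g)
    randomColouring-proper proper (σ , T) A B AB≡1 cA≡cB =
      proper (from T A) (from T B) (trans (isometric (Group._⁻¹ E2 T) A B) AB≡1)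
        (trans (sym (Inverse.strictlyInverseʳ σ _))
          (trans (cong (Inverse.from σ) cA≡cB) (Inverse.strictlyInverseʳ σ _)))

    module _ (P : LeftInvariantProbability S₄×E2 R) where
      open LeftInvariantProbability P
      open Probability R S₄×E2 P

      p : Point → Point → Carrier
      p A B = μ (monochromatic c₀ A B)

      -- Left translation by (id, T) carries the event for `A`, `B` onto the event for their images,
      -- and the measure is left-invariant.
      p-isometry : ∀ T A B → p (to T A) (to T B) ≡ p A B
      p-isometry T A B = trans
        (extensional {monochromatic c₀ (to T A) (to T B)}
                     {translate S₄×E2 g (monochromatic c₀ A B)} ((λ {x} → ⇒ {x}) , λ {x} → ⇐ {x}))
        (left-invariant g (monochromatic c₀ A B))
        where
        open Group S₄×E2 using (_≈_; _∙_)
        g : Group.Carrier S₄×E2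
        g = Group.ε (SymmetricGroup Colour) , T
        shift : ∀ h X → randomColouring c₀ (g ∙ h) (to T X) ≡ randomColouring c₀ h X
        shift (σ , S) X = cong (Inverse.to σ ∘ c₀ ∘ from S)
          (Inverse.strictlyInverseʳ (bijection T) X)
        ⇐ : ∀ {x} → (∃ λ h → randomColouring c₀ h A ≡ randomColouring c₀ h B × x ≈ g ∙ h) →
            randomColouring c₀ x (to T A) ≡ randomColouring c₀ x (to T B)
        ⇐ {x} (h , cA≡cB , x≈gh) = trans
          (trans (randomColouring-cong c₀ {x} {g ∙ h} x≈gh (to T A)) (shift h A))
          (trans cA≡cB
            (sym (trans (randomColouring-cong c₀ {x} {g ∙ h} x≈gh (to T B)) (shift h B))))
        ⇒ : ∀ {x} → randomColouring c₀ x (to T A) ≡ randomColouring c₀ x (to T B) →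
            ∃ λ h → randomColouring c₀ h A ≡ randomColouring c₀ h B × x ≈ g ∙ h
        -- The colouring of g⁻¹ x at `A` unfolds to that of `x` at `to T A`, so `cA≡cB` is reused
        -- unchanged.
        ⇒ {x} cA≡cB = Group._⁻¹ S₄×E2 g ∙ x , cA≡cB ,
          (λ _ → refl) , (λ X → sym (Inverse.strictlyInverseˡ (bijection T) _))

      -- This is why p_d depends on d alone: congruent nondegenerate pairs lie in one orbit of the
      -- isometries.
      p-congruent : ∀ A B C D → dist² A B ≡ dist² C D → dist² A B ≢ 0# → p C D ≡ p A B
      p-congruent A B C D AB≡CD AB≢0 =
        let T , TA≡C , TB≡D = congruent⇒isometry A B C D AB≡CD AB≢0
        in trans (sym (cong₂ p TA≡C TB≡D)) (p-isometry T A B)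

      -- The apex of an isosceles triangle with unit base matches at most one
      -- of the two base points.
      spindle : ProperColouring c₀ → ∀ O A B → dist² O A ≡ dist² O B → dist² O A ≢ 0# →
                dist² A B ≡ 1# → p O A + p O A ≤ 1#
      spindle proper O A B OA≡OB OA≢0 AB≡1 = subst (_≤ 1#)
        (trans (additive {monochromatic c₀ O A} {monochromatic c₀ O B} λ {g} → disjoint {g})
               (cong (p O A +_) (p-congruent O A O B OA≡OB OA≢0)))
        (μ≤1 {(_∪ˢ_ S₄×E2) (monochromatic c₀ O A) (monochromatic c₀ O B)}
          λ g → monochromatic? O A g ⊎-dec monochromatic? O B g)
        where
        disjoint : Subset.members (monochromatic c₀ O A) ⊥ Subset.members (monochromatic c₀ O B)
        disjoint {g} (cO≡cA , cO≡cB) =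
          randomColouring-proper proper g A B (dist²≡1⇒dist≡1 A B AB≡1)
            (trans (sym cO≡cA) cO≡cB)

-- The square with two triangles

-- Polymorphism lets one list serve both the points, which carry the probabilities, and their
-- colours, which are searched exhaustively; the two counts then agree definitionally.
longPairs diagonals testedPairs : ∀ {a} {A : Set a} (o a b c e f : A) → List (A × A)
longPairs   o a b c e f = (e , c) ∷ (e , b) ∷ (f , a) ∷ (f , b) ∷ (f , e) ∷ []
diagonals   o a b c e f = (a , c) ∷ (o , b) ∷ []
testedPairs o a b c e f = longPairs o a b c e f ++ diagonals o a b c e f

-- The case analysis is done by evaluating a decision procedure. The hypotheses are the eight unit
-- edges; each stands as soon as both its ends are quantified, so bad branches are cut before
-- further vertices are enumerated.
two-monochromatic-pairs : ∀ (o a : Fin 4) → o ≢ a → ∀ b → a ≢ b → ∀ c → b ≢ c → o ≢ c →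
  ∀ e → o ≢ e → a ≢ e → ∀ f → o ≢ f → c ≢ f →
  2 ℕ.≤ sum (map (λ (x , y) → indicator (x ≟ᶠ y)) (testedPairs o a b c e f))
two-monochromatic-pairs = toWitness {a? =
   all? λ o → all? λ a → ¬? (o ≟ᶠ a) →-dec
   all? λ b → ¬? (a ≟ᶠ b) →-dec
   all? λ c → ¬? (b ≟ᶠ c) →-dec ¬? (o ≟ᶠ c) →-dec
   all? λ e → ¬? (o ≟ᶠ e) →-dec ¬? (a ≟ᶠ e) →-dec
   all? λ f → ¬? (o ≟ᶠ f) →-dec ¬? (c ≟ᶠ f) →-dec
   (2 ℕ.≤? sum (map (λ (x , y) → indicator (x ≟ᶠ y)) (testedPairs o a b c e f)))} tt

module SquareWithTriangles (R : CompleteOrderedField) where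
  open CompleteOrderedField R
  open SquareRoot R
  open Plane R
  open Geometry R

  -- Keeping only two relations on `h` and `t`, which stand for 1/2 and √3/2, makes every distance
  -- below a polynomial identity modulo them. For positive `t` both triangles point out of the
  -- square.
  module Configuration (h t : Carrier) (h²+t²≡1 : h * h + t * t ≡ 1#) (2h≡1 : h + h ≡ 1#) where

    o a b c e f : Point
    o = 0# , 0#
    a = 1# , 0#
    b = 1# , 1#
    c = 0# , 1#
    e = h , - t
    f = - t , h

    private
      :o :a :b :c : ∀ {n} → Polynomial n × Polynomial n
      :o = con 0ℤ , con 0ℤ
      :a = con 1ℤ , con 0ℤ
      :b = con 1ℤ , con 1ℤ
      :c = con 0ℤ , con 1ℤ

      :e :f : ∀ {n} → Polynomial n → Polynomial n → Polynomial n × Polynomial n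
      :e h t = h , :- t
      :f h t = :- t , h

      :combination : ∀ {n} (h t y α β : Polynomial n) → Polynomial n
      :combination h t y α β =
        y :+ α :* (h :* h :+ t :* t :- con 1ℤ) :+ β :* (h :+ h :- con 1ℤ)

      -- The cofactors `α` and `β` certify that x - y lies in the ideal of the two relations.
      reduce : ∀ {x y} α β →
               x ≡ y + α * (h * h + t * t - 1#) + β * (h + h - 1#) → x ≡ y
      reduce α β eq = modulo h²+t²≡1 α (modulo 2h≡1 β eq)

    oa : dist² o a ≡ 1#
    oa = solve 0 (:dist² :o :a := con 1ℤ) refl
    ab : dist² a b ≡ 1#
    ab = solve 0 (:dist² :a :b := con 1ℤ) refl
    bc : dist² b c ≡ 1#
    bc = solve 0 (:dist² :b :c := con 1ℤ) refl
    oc : dist² o c ≡ 1#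
    oc = solve 0 (:dist² :o :c := con 1ℤ) refl
    ac : dist² a c ≡ 1# + 1#
    ac = solve 0 (:dist² :a :c := con 1ℤ :+ con 1ℤ) refl
    ob : dist² o b ≡ 1# + 1#
    ob = solve 0 (:dist² :o :b := con 1ℤ :+ con 1ℤ) refl

    oe : dist² o e ≡ 1#
    oe = reduce 1# 0# (solve 2 (λ h t → :dist² :o (:e h t)
      := :combination h t (con 1ℤ) (con 1ℤ) (con 0ℤ)) refl h t)
    ae : dist² a e ≡ 1#
    ae = reduce 1# (- 1#) (solve 2 (λ h t → :dist² :a (:e h t)
      := :combination h t (con 1ℤ) (con 1ℤ) (:- con 1ℤ)) refl h t)
    of′ : dist² o f ≡ 1#
    of′ = reduce 1# 0# (solve 2 (λ h t → :dist² :o (:f h t)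
      := :combination h t (con 1ℤ) (con 1ℤ) (con 0ℤ)) refl h t)
    cf : dist² c f ≡ 1#
    cf = reduce 1# (- 1#) (solve 2 (λ h t → :dist² :c (:f h t)
      := :combination h t (con 1ℤ) (con 1ℤ) (:- con 1ℤ)) refl h t)

    -- With t = √3/2 this is 2 + √3, the square of (√6 + √2)/2.
    long : Carrier
    long = 1# + 1# + (t + t)

    private
      :long : ∀ {n} → Polynomial n → Polynomial n
      :long t = con 1ℤ :+ con 1ℤ :+ (t :+ t)

    ec : dist² e c ≡ long
    ec = reduce 1# 0# (solve 2 (λ h t → :dist² (:e h t) :c
      := :combination h t (:long t) (con 1ℤ) (con 0ℤ)) refl h t)
    eb : dist² e b ≡ long
    eb = reduce 1# (- 1#) (solve 2 (λ h t → :dist² (:e h t) :b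
      := :combination h t (:long t) (con 1ℤ) (:- con 1ℤ)) refl h t)
    fa : dist² f a ≡ long
    fa = reduce 1# 0# (solve 2 (λ h t → :dist² (:f h t) :a
      := :combination h t (:long t) (con 1ℤ) (con 0ℤ)) refl h t)
    fb : dist² f b ≡ long
    fb = reduce 1# (- 1#) (solve 2 (λ h t → :dist² (:f h t) :b
      := :combination h t (:long t) (con 1ℤ) (:- con 1ℤ)) refl h t)
    fe : dist² f e ≡ long
    -- The squared distance is 2 (h + t)²; its cross term 4 h t becomes 2 t by 2 h = 1, whence the
    -- cofactor `t + t`.
    fe = reduce (1# + 1#) (t + t) (solve 2 (λ h t → :dist² (:f h t) (:e h t)
      := :combination h t (:long t) (con 1ℤ :+ con 1ℤ) (t :+ t)) refl h t)

-- Coordinates in the field and the final estimate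

module Bound (R : CompleteOrderedField) where
  open CompleteOrderedField R
  open SquareRoot R
  open Plane R
  open Colouring R
  open Geometry R

  -- This evaluates to the very sum of ones that `fromℕ` unfolds to; an integer constant would
  -- evaluate to a differently bracketed sum.
  :fromℕ : ∀ {n} → ℕ → Polynomial n
  :fromℕ zero    = con 0ℤ
  :fromℕ (suc k) = con 1ℤ :+ :fromℕ k

  fromℕ-nonNeg : ∀ n → 0# ≤ fromℕ n
  fromℕ-nonNeg zero    = ≤-refl
  fromℕ-nonNeg (suc n) = +-nonNeg 0≤1 (fromℕ-nonNeg n)

  1≤⇒≢0 : ∀ {x} → 1# ≤ x → x ≢ 0#
  1≤⇒≢0 1≤x x≡0 = 0≢1 (antisym 0≤1 (subst (1# ≤_) x≡0 1≤x))

  fromℕ-suc≢0 : ∀ n → fromℕ (suc n) ≢ 0#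
  fromℕ-suc≢0 n = 1≤⇒≢0 (x≤x+y 1# (fromℕ-nonNeg n))

  -- t is √3/2, written so that d * d ≡ 2 + 2t needs no identity between square roots.
  h d t w : Carrier
  h = fromℕ 2 ⁻¹
  d = (√ (fromℕ 6) + √ (fromℕ 2)) / fromℕ 2
  t = √ (fromℕ 6) * √ (fromℕ 2) * (h * h)
  w = √ (fromℕ 7) * h

  2h≡1 : h + h ≡ 1#
  2h≡1 = trans (solve 1 (λ h → h :+ h := :fromℕ 2 :* h) refl h)
               (*-inverseʳ (fromℕ 2) (fromℕ-suc≢0 1))

  √-fromℕ : ∀ n → √ (fromℕ n) * √ (fromℕ n) ≡ fromℕ n
  √-fromℕ n = √-square (fromℕ-nonNeg n)

  h²+t²≡1 : h * h + t * t ≡ 1#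
  h²+t²≡1 = begin
    h * h + t * t
      ≡⟨ solve 3 (λ r s h → h :* h :+ r :* s :* (h :* h) :* (r :* s :* (h :* h))
           := h :* h :+ (r :* r) :* (s :* s) :* (h :* h :* (h :* h))) refl _ _ h ⟩
    h * h + (√ (fromℕ 6) * √ (fromℕ 6)) * (√ (fromℕ 2) * √ (fromℕ 2)) * (h * h * (h * h))
      ≡⟨ cong₂ (λ x y → h * h + x * y * (h * h * (h * h))) (√-fromℕ 6) (√-fromℕ 2) ⟩
    h * h + fromℕ 6 * fromℕ 2 * (h * h * (h * h))
      -- The cofactor comes from 12 h⁴ + h² - 1 = (3 h² + 1)(2 h + 1)(2 h - 1).
      ≡⟨ modulo 2h≡1 (1# + (h + h) + (fromℕ 3 * (h * h)) * (1# + (h + h)))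
           (solve 1 (λ h → h :* h :+ :fromℕ 6 :* :fromℕ 2 :* (h :* h :* (h :* h))
             := con 1ℤ :+ (con 1ℤ :+ (h :+ h) :+ (:fromℕ 3 :* (h :* h)) :* (con 1ℤ :+ (h :+ h)))
                          :* (h :+ h :- con 1ℤ)) refl h) ⟩
    1# ∎
    where open ≡-Reasoning

  open SquareWithTriangles R
  open Configuration h t h²+t²≡1 2h≡1

  -- Each of the two cross terms is `t` by definition, and the squares contribute (6 + 2)/4 = 2.
  d²≡long : d * d ≡ long
  d²≡long = begin
    d * d
      ≡⟨ solve 3 (λ r s h → (r :+ s) :* h :* ((r :+ s) :* h)
           := (r :* r :+ s :* s) :* (h :* h) :+ (r :* s :* (h :* h) :+ r :* s :* (h :* h)))
           refl _ _ h ⟩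
    (√ (fromℕ 6) * √ (fromℕ 6) + √ (fromℕ 2) * √ (fromℕ 2)) * (h * h) + (t + t)
      ≡⟨ cong₂ (λ x y → (x + y) * (h * h) + (t + t)) (√-fromℕ 6) (√-fromℕ 2) ⟩
    (fromℕ 6 + fromℕ 2) * (h * h) + (t + t)
      ≡⟨ modulo 2h≡1 (fromℕ 2 + fromℕ 2 * (h + h))
           (solve 2 (λ h t → (:fromℕ 6 :+ :fromℕ 2) :* (h :* h) :+ (t :+ t)
             := con 1ℤ :+ con 1ℤ :+ (t :+ t) :+
                (:fromℕ 2 :+ :fromℕ 2 :* (h :+ h)) :* (h :+ h :- con 1ℤ)) refl h t) ⟩
    long ∎
    where open ≡-Reasoning

  1≤long : 1# ≤ long
  1≤long = ≤-trans (x≤x+y 1# 0≤1) (x≤x+y (1# + 1#) (+-nonNeg 0≤t 0≤t))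
    where
    0≤t : 0# ≤ t
    0≤t = *-nonNeg (*-nonNeg (√-nonNeg _) (√-nonNeg _)) (x*x-nonNeg h)

  -- This is Pythagoras in half of the isosceles triangle with legs √2 and base 1, whose height is
  -- √7/2.
  w²+h²≡2 : w * w + h * h ≡ 1# + 1#
  w²+h²≡2 = begin
    w * w + h * h
      ≡⟨ solve 2 (λ r h → r :* h :* (r :* h) :+ h :* h := r :* r :* (h :* h) :+ h :* h)
           refl _ h ⟩
    √ (fromℕ 7) * √ (fromℕ 7) * (h * h) + h * h
      ≡⟨ cong (λ x → x * (h * h) + h * h) (√-fromℕ 7) ⟩
    fromℕ 7 * (h * h) + h * h
      ≡⟨ modulo 2h≡1 (fromℕ 2 + fromℕ 2 * (h + h))
           (solve 1 (λ h → :fromℕ 7 :* (h :* h) :+ h :* h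
             := con 1ℤ :+ con 1ℤ :+
                (:fromℕ 2 :+ :fromℕ 2 :* (h :+ h)) :* (h :+ h :- con 1ℤ)) refl h) ⟩
    1# + 1# ∎
    where open ≡-Reasoning

  -- The first hypothesis has the shape of the unfolded `foldr` over the seven pairs. Eliminating
  -- `y` leaves 1 ≤ 5 x, that is x ≥ 15/75.
  13/75≤ : ∀ {x y} → fromℕ 2 ≤ x + (x + (x + (x + (x + (y + (y + 0#)))))) → y + y ≤ 1# →
           fromℕ 13 / fromℕ 75 ≤ x
  13/75≤ {x} {y} 2≤5x+2y 2y≤1 = *-cancelˡ-≤ (fromℕ-nonNeg 75) (fromℕ-suc≢0 74) (begin
    fromℕ 75 * (fromℕ 13 / fromℕ 75)   ≡⟨ *-cancel-⁻¹ (fromℕ-suc≢0 74) (fromℕ 13) ⟩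
    fromℕ 13                           ≤⟨ x≤x+y (fromℕ 13) (fromℕ-nonNeg 2) ⟩
    fromℕ 13 + fromℕ 2
      ≡⟨ solve 0 (:fromℕ 13 :+ :fromℕ 2 := :fromℕ 15 :* con 1ℤ) refl ⟩
    fromℕ 15 * 1#                      ≤⟨ *-monoˡ-≤ (fromℕ-nonNeg 15) 1≤5x ⟩
    fromℕ 15 * (fromℕ 5 * x)
      ≡⟨ solve 1 (λ x → :fromℕ 15 :* (:fromℕ 5 :* x) := :fromℕ 75 :* x) refl x ⟩
    fromℕ 75 * x                       ∎)
    where
    open PosetReasoning (≤-poset R)
    1≤5x : 1# ≤ fromℕ 5 * x
    1≤5x = +-cancelˡ-≤ 1# (begin
      1# + 1#                    ≡⟨ solve 0 (con 1ℤ :+ con 1ℤ := :fromℕ 2) refl ⟩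
      fromℕ 2                    ≤⟨ 2≤5x+2y ⟩
      x + (x + (x + (x + (x + (y + (y + 0#))))))
        ≡⟨ solve 2 (λ x y → x :+ (x :+ (x :+ (x :+ (x :+ (y :+ (y :+ con 0ℤ))))))
             := y :+ y :+ :fromℕ 5 :* x) refl x y ⟩
      y + y + fromℕ 5 * x        ≤⟨ +-monoˡ-≤ (fromℕ 5 * x) 2y≤1 ⟩
      1# + fromℕ 5 * x           ∎)

  module _ (c₀ : Point → Colour) (proper : ProperColouring c₀)
           (P : LeftInvariantProbability S₄×E2 R)
           (A B : Point) (AB≡d : dist A B ≡ d) where
    open Probability R S₄×E2 P using (multiple-cover)
    open Probabilities R

    private
      prob : Point → Point → Carrier
      prob = p c₀ P

      differ : ∀ g X Y → dist² X Y ≡ 1# → randomColouring c₀ g X ≢ randomColouring c₀ g Y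
      differ g X Y XY≡1 = randomColouring-proper c₀ proper g X Y (dist²≡1⇒dist≡1 X Y XY≡1)

      AB≡long : dist² A B ≡ long
      AB≡long = trans (sym (dist-squared A B)) (trans (cong (λ z → z * z) AB≡d) d²≡long)

      long-prob : ∀ X Y → dist² X Y ≡ long → prob X Y ≡ prob A B
      long-prob X Y XY≡long = p-congruent c₀ P A B X Y (trans AB≡long (sym XY≡long))
        λ AB≡0 → 1≤⇒≢0 1≤long (trans (sym AB≡long) AB≡0)

      apex base⁺ base⁻ : Point
      apex  = 0# , 0#
      base⁺ = w , h
      base⁻ = w , - h

      :apex-dist² : ∀ {n} → Polynomial n → Polynomial n → Polynomial n
      :apex-dist² w h = :dist² (con 0ℤ , con 0ℤ) (w , h)

      apex-base⁺ : dist² apex base⁺ ≡ 1# + 1#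
      apex-base⁺ = trans
        (solve 2 (λ w h → :apex-dist² w h := w :* w :+ h :* h) refl w h) w²+h²≡2

      apex-base⁻ : dist² apex base⁻ ≡ 1# + 1#
      apex-base⁻ = trans
        (solve 2 (λ w h → :apex-dist² w (:- h) := w :* w :+ h :* h) refl w h) w²+h²≡2

      base : dist² base⁺ base⁻ ≡ 1#
      base = modulo 2h≡1 (1# + (h + h)) (solve 2 (λ w h → :dist² (w , h) (w , :- h)
        := con 1ℤ :+ (con 1ℤ :+ (h :+ h)) :* (h :+ h :- con 1ℤ)) refl w h)

      apex-base⁺≢0 : dist² apex base⁺ ≢ 0#
      apex-base⁺≢0 = λ eq → 1≤⇒≢0 (x≤x+y 1# 0≤1) (trans (sym apex-base⁺) eq)

      diagonal-prob : ∀ X Y → dist² X Y ≡ 1# + 1# → prob X Y ≡ prob apex base⁺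
      diagonal-prob X Y XY≡2 =
        p-congruent c₀ P apex base⁺ X Y (trans apex-base⁺ (sym XY≡2)) apex-base⁺≢0

      two-pairs : fromℕ 2 ≤ foldr _+_ 0# (map (uncurry prob) (testedPairs o a b c e f))
      two-pairs = multiple-cover (λ (X , Y) → monochromatic c₀ X Y)
        (λ (X , Y) → monochromatic? c₀ X Y) 2 (testedPairs o a b c e f) λ g →
        -- The colours are inferred from the types of the `differ` proofs.
        two-monochromatic-pairs _ _ (differ g o a oa) _ (differ g a b ab)
          _ (differ g b c bc) (differ g o c oc) _ (differ g o e oe) (differ g a e ae)
          _ (differ g o f of′) (differ g c f cf)

    13/75≤p : fromℕ 13 / fromℕ 75 ≤ prob A B
    13/75≤p = 13/75≤
      (subst (fromℕ 2 ≤_)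
        -- Five summands become the probability for `A`, `B`, and two become that for one leg of the
        -- isosceles triangle.
        (cong₂ _+_ (long-prob e c ec) (cong₂ _+_ (long-prob e b eb)
        (cong₂ _+_ (long-prob f a fa) (cong₂ _+_ (long-prob f b fb)
        (cong₂ _+_ (long-prob f e fe) (cong₂ _+_ (diagonal-prob a c ac)
        (cong₂ _+_ (diagonal-prob o b ob) refl)))))))
        two-pairs)
      (spindle c₀ P proper apex base⁺ base⁻ (trans apex-base⁺ (sym apex-base⁻))
        apex-base⁺≢0 base)

mainTheorem3 : (R : CompleteOrderedField) →
    let open CompleteOrderedField R
        open SquareRoot R
        open Plane R
        open Colouring R
    in
    (c₀ : Point → Colour) → ProperColouring c₀ →
    (P : LeftInvariantProbability S₄×E2 R) →
    (A B : Point) → dist A B ≡ (√ (fromℕ 6) + √ (fromℕ 2)) / fromℕ 2 →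
    fromℕ 13 / fromℕ 75 ≤ LeftInvariantProbability.μ P (monochromatic c₀ A B)
mainTheorem3 R = Bound.13/75≤p R
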